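{- Let $p$ be an odd prime and let $k$ be an integer with $2\le k\le p-1$. Let $T$ be an orthogonal trade in $B_p$ of index $(1,k)$, let $s$ be a symbol occurring in $T$, and let $R\subseteq\mathbb{Z}_p$ be the set of rows $r$ such that $T$ contains a triple $(r,c,s)$ for some $c$. Then there exist a permutation $\phi$ of $R$ with no fixed points such that $U=\{(r,c,r+c): r\in R,\ c\in\mathbb{Z}_p\}$ is an orthogonal trade in $B_p$ of index $(1,k)$ with disjoint mate $U'=\{(r,c,\phi(r)+c): r\in R,\ c\in\mathbb{Z}_p\}$ (i.e. obtained by permuting the rows of $B_p$ indexed by $R$); in particular this trade has size $p|R|$.
   Context: All arithmetic is modulo $p$. A Latin square of order $p$ is viewed as a set of (row, column, symbol) triples in $\mathbb{Z}_p^3$. For $1\le k\le p-1$, $B_p(k)$ is the Latin square with symbol $ki+j$ in cell $(i,j)$, $i,j\in\mathbb{Z}_p$; $B_p=B_p(1)$. A Latin trade in a Latin square $L$ is a subset $T\subseteq L$ for which there is a partial Latin square $T'$ (a disjoint mate) such that $T$ and $T'$ occupy the same set of cells, $T\cap T'=\emptyset$, and each row (respectively column) of $T$ contains the same set of symbols as the corresponding row (column) of $T'$. Two Latin squares of order $p$ are orthogonal if superimposing them yields each of the $p^2$ ordered pairs exactly once. An orthogonal trade of index $(\ell,k)$ is a Latin trade $T\subseteq B_p(\ell)$ having a disjoint mate $T'$ such that $(B_p(\ell)\setminus T)\cup T'$ is orthogonal to $B_p(k)$. -}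

module Defs where

open import Data.Fin using (Fin; toℕ)
open import Data.Fin.Properties using (any?; nonZeroIndex; _≟_)
open import Data.List using (List; length; filter; allFin; cartesianProduct)
open import Data.Nat using (ℕ; _+_; _*_)
open import Data.Nat.DivMod using (_mod_)
open import Data.Product using (∃; ∃!; ∃₂; _×_; _,_)
open import Function.Bundles using (_⇔_)
open import Level using (0ℓ)
open import Relation.Binary.PropositionalEquality using (_≡_)
open import Relation.Nullary.Decidable using (_×-dec_)
open import Relation.Unary using (Pred; Decidable; _∈_; _⊆_; _∪_; _∖_; _⊥_)

private
  variable
    p : ℕ

-- ℤ_p is Fin p. The modulus is nonzero because Fin p has an element.

infixl 6 _⊕_
infixl 7 _·_

_⊕_ : Fin p → Fin p → Fin p
_⊕_ {p} i j = _mod_ (toℕ i + toℕ j) p {{nonZeroIndex i}}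

_·_ : ℕ → Fin p → Fin p
_·_ {p} k i = _mod_ (k * toℕ i) p {{nonZeroIndex i}}

-- (row , column , symbol)
Triple : ℕ → Set
Triple p = Fin p × Fin p × Fin p

TripleSet : ℕ → Set₁
TripleSet p = Pred (Triple p) 0ℓ

record IsLatinSquare (L : TripleSet p) : Set where
  field
    cell   : ∀ i j → ∃! _≡_ λ s → (i , j , s) ∈ L
    row    : ∀ i s → ∃! _≡_ λ j → (i , j , s) ∈ L
    column : ∀ j s → ∃! _≡_ λ i → (i , j , s) ∈ L

record IsPartialLatinSquare (L : TripleSet p) : Set where
  field
    cell   : ∀ {i j s s′} → (i , j , s) ∈ L → (i , j , s′) ∈ L → s ≡ s′
    row    : ∀ {i j j′ s} → (i , j , s) ∈ L → (i , j′ , s) ∈ L → j ≡ j′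
    column : ∀ {i i′ j s} → (i , j , s) ∈ L → (i′ , j , s) ∈ L → i ≡ i′

B : ℕ → TripleSet p
B k (i , j , s) = s ≡ k · i ⊕ j

-- T is a Latin trade in the Latin square L, with disjoint mate T′.
record IsLatinTradeWithMate (L T T′ : TripleSet p) : Set where
  field
    latin         : IsLatinSquare L
    subset        : T ⊆ L
    partialLatin  : IsPartialLatinSquare T′
    sameCells     : ∀ i j → (∃ λ s → (i , j , s) ∈ T) ⇔ (∃ λ s → (i , j , s) ∈ T′)
    disjoint      : T ⊥ T′
    rowSymbols    : ∀ i s → (∃ λ j → (i , j , s) ∈ T) ⇔ (∃ λ j → (i , j , s) ∈ T′)
    columnSymbols : ∀ j s → (∃ λ i → (i , j , s) ∈ T) ⇔ (∃ λ i → (i , j , s) ∈ T′)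

record AreOrthogonal (L M : TripleSet p) : Set where
  field
    latinˡ      : IsLatinSquare L
    latinʳ      : IsLatinSquare M
    superimpose : ∀ x y → ∃! _≡_ λ ((i , j) : Fin p × Fin p) →
                    (i , j , x) ∈ L × (i , j , y) ∈ M

record IsOrthogonalTradeWithMate (ℓ k : ℕ) (T T′ : TripleSet p) : Set where
  field
    latinTrade : IsLatinTradeWithMate (B ℓ) T T′
    orthogonal : AreOrthogonal ((B ℓ ∖ T) ∪ T′) (B k)

-- Orthogonal trade of index (ℓ , k).
IsOrthogonalTrade : (ℓ k : ℕ) → TripleSet p → Set₁
IsOrthogonalTrade ℓ k T = ∃ λ T′ → IsOrthogonalTradeWithMate ℓ k T T′

OccursIn : Fin p → TripleSet p → Set
OccursIn s T = ∃₂ λ r c → (r , c , s) ∈ T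

rowsContaining : Fin p → TripleSet p → Pred (Fin p) 0ℓ
rowsContaining s T r = ∃ λ c → (r , c , s) ∈ T

rowsContaining? : ∀ (s : Fin p) {T : TripleSet p} →
                  Decidable T → Decidable (rowsContaining s T)
rowsContaining? s T? r = any? λ c → T? (r , c , s)

-- φ restricts to a permutation of R; its values outside R are irrelevant.
record IsPermutationOf (R : Pred (Fin p) 0ℓ) (φ : Fin p → Fin p) : Set where
  field
    maps       : ∀ {r} → r ∈ R → φ r ∈ R
    injective  : ∀ {r r′} → r ∈ R → r′ ∈ R → φ r ≡ φ r′ → r ≡ r′
    surjective : ∀ {r′} → r′ ∈ R → ∃ λ r → r ∈ R × φ r ≡ r′

-- { (r , c , φ(r) + c) : r ∈ R , c ∈ ℤ_p }
permutedRows : Pred (Fin p) 0ℓ → (Fin p → Fin p) → TripleSet p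
permutedRows R φ (r , c , s) = r ∈ R × s ≡ φ r ⊕ c

permutedRows? : ∀ {R : Pred (Fin p) 0ℓ} → Decidable R →
                ∀ φ → Decidable (permutedRows R φ)
permutedRows? R? φ (r , c , s) = R? r ×-dec (s ≟ φ r ⊕ c)

allTriples : ∀ p → List (Triple p)
allTriples p = cartesianProduct (allFin p) (cartesianProduct (allFin p) (allFin p))

∣_∣ᵣ : {R : Pred (Fin p) 0ℓ} → Decidable R → ℕ
∣_∣ᵣ {p} R? = length (filter R? (allFin p))

∣_∣ₜ : {T : TripleSet p} → Decidable T → ℕ
∣_∣ₜ {p} T? = length (filter T? (allTriples p))

-- In L′ = (B₁ ∖ T) ∪ T′ the symbol s meets each row r in a single column σ r.
-- Writing that cell as (r , σ r , φ r ⊕ σ r) defines φ, which fixes the rows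
-- outside R and is a derangement of R because T and T′ use the same symbols in
-- every column but are disjoint. Orthogonality of L′ with B_k, restricted to
-- the symbol s, says that r ↦ k r + σ r = k r − φ r + s is a bijection, and
-- this is all that is needed for { (r , c , φ r ⊕ c) } to be orthogonal to B_k.
module Submission where

open import Defs
open import Algebra.Bundles using (CommutativeSemigroup)
import Algebra.Properties.CommutativeSemigroup as CommutativeSemigroupProperties
open import Algebra.Structures using (IsCommutativeSemigroup)
open import Data.Empty using (⊥-elim)
open import Data.Fin using (Fin; toℕ)
open import Data.Fin.Properties
  using (nonZeroIndex; toℕ-fromℕ<; toℕ-injective; toℕ<n)
open import Data.List using (List; []; _∷_; _++_; length; filter; map; allFin; cartesianProduct)
open import Data.List.Membership.Propositional using () renaming (_∈_ to _∈ˡ_)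
open import Data.List.Membership.Propositional.Properties using (∈-allFin)
open import Data.List.Properties
  using (filter-++; length-++; filter-all; filter-none; filter-accept; filter-reject;
         length-tabulate)
open import Data.List.Relation.Unary.All as All using ()
open import Data.List.Relation.Unary.AllPairs using (_∷_)
open import Data.List.Relation.Unary.Any using (here; there)
open import Data.List.Relation.Unary.Unique.Propositional using (Unique)
open import Data.List.Relation.Unary.Unique.Propositional.Properties using (allFin⁺)
open import Data.Nat using (ℕ; NonZero; _+_; _*_; _∸_; _≤_)
open import Data.Nat.Divisibility using (_∣_)
open import Data.Nat.DivMod using (_%_; m%n%n≡m%n; m<n⇒m%n≡m; %-distribˡ-+)
open import Data.Nat.Primality using (Prime)
open import Data.Nat.Properties using (+-comm; +-assoc; +-identityʳ; *-zeroʳ; *-suc)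
open import Data.Product using (∃; ∃!; _×_; _,_; proj₁; proj₂)
open import Data.Sum using (_⊎_; inj₁; inj₂)
open import Function using (id; _∘_; mk⇔; Equivalence)
open import Level using (0ℓ)
open import Relation.Binary.PropositionalEquality
open import Relation.Nullary using (Dec; ¬_; yes; no)
open import Relation.Unary using (Pred; Decidable; _∈_; _∉_; _∪_; _∖_)

private
  variable
    A C : Set
    p : ℕ

-- Unique existence and addition modulo `p`.

∃!-unique : {P : A → Set} {x y : A} → ∃! _≡_ P → P x → P y → x ≡ y
∃!-unique (_ , _ , unique) Px Py = trans (sym (unique Px)) (unique Py)

%-absorbˡ-+ : ∀ m o n .{{_ : NonZero n}} → (m % n + o) % n ≡ (m + o) % n
%-absorbˡ-+ m o n = begin
  (m % n + o) % n          ≡⟨ %-distribˡ-+ (m % n) o n ⟩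
  (m % n % n + o % n) % n  ≡⟨ cong (λ z → (z + o % n) % n) (m%n%n≡m%n m n) ⟩
  (m % n + o % n) % n      ≡⟨ %-distribˡ-+ m o n ⟨
  (m + o) % n              ∎
  where open ≡-Reasoning

toℕ-⊕ : .{{_ : NonZero p}} (i j : Fin p) → toℕ (i ⊕ j) ≡ (toℕ i + toℕ j) % p
toℕ-⊕ i j = toℕ-fromℕ< _

⊕-comm : (i j : Fin p) → i ⊕ j ≡ j ⊕ i
⊕-comm {p} i j = toℕ-injective (begin
  toℕ (i ⊕ j)          ≡⟨ toℕ-⊕ i j ⟩
  (toℕ i + toℕ j) % p  ≡⟨ cong (_% p) (+-comm (toℕ i) (toℕ j)) ⟩
  (toℕ j + toℕ i) % p  ≡⟨ toℕ-⊕ j i ⟨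
  toℕ (j ⊕ i)          ∎)
  where
  open ≡-Reasoning
  instance _ = nonZeroIndex i

⊕-assoc : (i j l : Fin p) → (i ⊕ j) ⊕ l ≡ i ⊕ (j ⊕ l)
⊕-assoc {p} i j l = toℕ-injective (begin
  toℕ ((i ⊕ j) ⊕ l)                    ≡⟨ toℕ-⊕ (i ⊕ j) l ⟩
  (toℕ (i ⊕ j) + toℕ l) % p            ≡⟨ cong (λ z → (z + toℕ l) % p) (toℕ-⊕ i j) ⟩
  ((toℕ i + toℕ j) % p + toℕ l) % p    ≡⟨ %-absorbˡ-+ (toℕ i + toℕ j) (toℕ l) p ⟩
  (toℕ i + toℕ j + toℕ l) % p          ≡⟨ cong (_% p) (+-assoc (toℕ i) (toℕ j) (toℕ l)) ⟩
  -- The sum is commuted because `%-absorbˡ-+` absorbs a reduction only in the left summand.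
  (toℕ i + (toℕ j + toℕ l)) % p        ≡⟨ cong (_% p) (+-comm (toℕ i) (toℕ j + toℕ l)) ⟩
  (toℕ j + toℕ l + toℕ i) % p          ≡⟨ %-absorbˡ-+ (toℕ j + toℕ l) (toℕ i) p ⟨
  ((toℕ j + toℕ l) % p + toℕ i) % p    ≡⟨ cong (λ z → (z + toℕ i) % p) (toℕ-⊕ j l) ⟨
  (toℕ (j ⊕ l) + toℕ i) % p            ≡⟨ toℕ-⊕ (j ⊕ l) i ⟨
  toℕ ((j ⊕ l) ⊕ i)                    ≡⟨ cong toℕ (⊕-comm (j ⊕ l) i) ⟩
  toℕ (i ⊕ (j ⊕ l))                    ∎)
  where
  open ≡-Reasoning
  instance _ = nonZeroIndex i

·-identityˡ : (i : Fin p) → 1 · i ≡ i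
·-identityˡ {p} i = toℕ-injective (begin
  toℕ (1 · i)      ≡⟨ toℕ-fromℕ< _ ⟩
  (1 * toℕ i) % p  ≡⟨ cong (_% p) (+-identityʳ (toℕ i)) ⟩
  toℕ i % p        ≡⟨ m<n⇒m%n≡m (toℕ<n i) ⟩
  toℕ i            ∎)
  where
  open ≡-Reasoning
  instance _ = nonZeroIndex i

⊕-isCommutativeSemigroup : IsCommutativeSemigroup {A = Fin p} _≡_ _⊕_
⊕-isCommutativeSemigroup = record
  { isSemigroup = record
    { isMagma = record { isEquivalence = isEquivalence ; ∙-cong = cong₂ _⊕_ }
    ; assoc   = ⊕-assoc
    }
  ; comm = ⊕-comm
  }

-- Used to exchange the columns of two cells of one row: `a` and `c` become the row terms `k · i`
-- and `φ i`, while `b` and `d` become the columns.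
⊕-swapʳ : (a b c d : Fin p) → (a ⊕ b) ⊕ (c ⊕ d) ≡ (a ⊕ d) ⊕ (c ⊕ b)
⊕-swapʳ {p} a b c d = begin
  (a ⊕ b) ⊕ (c ⊕ d)  ≡⟨ cong ((a ⊕ b) ⊕_) (⊕-comm c d) ⟩
  (a ⊕ b) ⊕ (d ⊕ c)  ≡⟨ interchange a b d c ⟩
  (a ⊕ d) ⊕ (b ⊕ c)  ≡⟨ cong ((a ⊕ d) ⊕_) (⊕-comm b c) ⟩
  (a ⊕ d) ⊕ (c ⊕ b)  ∎
  where
  open ≡-Reasoning
  ⊕-commutativeSemigroup : CommutativeSemigroup 0ℓ 0ℓ
  ⊕-commutativeSemigroup = record { isCommutativeSemigroup = ⊕-isCommutativeSemigroup {p} }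
  open CommutativeSemigroupProperties ⊕-commutativeSemigroup using (interchange)

-- Counting triples.

module _ {P : Pred A 0ℓ} (P? : Decidable P) where

  length-filter-map : (f : C → A) (zs : List C) →
    length (filter P? (map f zs)) ≡ length (filter (P? ∘ f) zs)
  length-filter-map f [] = refl
  length-filter-map f (z ∷ zs) with P? (f z)
  ... | yes _ = cong ℕ.suc (length-filter-map f zs)
  ... | no  _ = length-filter-map f zs

module _ {P : Pred (A × C) 0ℓ} (P? : Decidable P) {Q : Pred A 0ℓ} (Q? : Decidable Q)
         (n : ℕ) (ys : List C)
         (accept : ∀ {x} → x ∈ Q → length (filter (λ y → P? (x , y)) ys) ≡ n)
         (reject : ∀ {x y} → x ∉ Q → ¬ P (x , y)) where

  -- Counts by fibres over the first coordinate. It serves twice: over rows with fibres of size `p`,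
  -- then over the columns of one row with fibres of size 1.
  length-filter-cartesianProduct : (xs : List A) →
    length (filter P? (cartesianProduct xs ys)) ≡ n * length (filter Q? xs)
  length-filter-cartesianProduct [] = sym (*-zeroʳ n)
  length-filter-cartesianProduct (x ∷ xs) = trans split (step (Q? x))
    where
    open ≡-Reasoning
    fibre rest : ℕ
    fibre = length (filter (λ y → P? (x , y)) ys)
    rest  = length (filter P? (cartesianProduct xs ys))

    split : length (filter P? (cartesianProduct (x ∷ xs) ys)) ≡ fibre + rest
    split = begin
      length (filter P? (cartesianProduct (x ∷ xs) ys))
        ≡⟨ cong length (filter-++ P? (map (x ,_) ys) (cartesianProduct xs ys)) ⟩
      length (filter P? (map (x ,_) ys) ++ filter P? (cartesianProduct xs ys))
        ≡⟨ length-++ (filter P? (map (x ,_) ys)) ⟩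
      length (filter P? (map (x ,_) ys)) + rest
        ≡⟨ cong (_+ rest) (length-filter-map P? (x ,_) ys) ⟩
      fibre + rest ∎

    step : Dec (Q x) → fibre + rest ≡ n * length (filter Q? (x ∷ xs))
    step (yes Qx) = begin
      fibre + rest                         ≡⟨ cong₂ _+_ (accept Qx) (length-filter-cartesianProduct xs) ⟩
      n + n * length (filter Q? xs)        ≡⟨ *-suc n _ ⟨
      n * length (x ∷ filter Q? xs)        ≡⟨ cong (λ zs → n * length zs) (filter-accept Q? Qx) ⟨
      n * length (filter Q? (x ∷ xs))      ∎
    step (no ¬Qx) = begin
      fibre + rest                         ≡⟨ cong (λ zs → length zs + rest)
                                                (filter-none (λ y → P? (x , y))
                                                  (All.universal (λ _ → reject ¬Qx) ys)) ⟩
      rest                                 ≡⟨ length-filter-cartesianProduct xs ⟩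
      n * length (filter Q? xs)            ≡⟨ cong (λ zs → n * length zs) (filter-reject Q? ¬Qx) ⟨
      n * length (filter Q? (x ∷ xs))      ∎

length-filter-unique : {P : Pred A 0ℓ} (P? : Decidable P) {a : A} →
  P a → (∀ {x} → P x → a ≡ x) →
  {xs : List A} → Unique xs → a ∈ˡ xs → length (filter P? xs) ≡ 1
length-filter-unique P? Pa unique {x ∷ xs} (x∉xs ∷ _) (here refl) = begin
  length (filter P? (x ∷ xs))  ≡⟨ cong length (filter-accept P? Pa) ⟩
  length (x ∷ filter P? xs)    ≡⟨ cong (λ zs → length (x ∷ zs))
                                    (filter-none P? (All.map (λ x≢y → x≢y ∘ unique) x∉xs)) ⟩
  1                            ∎
  where open ≡-Reasoning
length-filter-unique P? Pa unique {x ∷ xs} (x∉xs ∷ xs!) (there a∈xs) = trans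
  (cong length (filter-reject P? λ Px → All.lookup x∉xs a∈xs (sym (unique Px))))
  (length-filter-unique P? Pa unique xs! a∈xs)

∣permutedRows∣ : {R : Pred (Fin p) 0ℓ} (R? : Decidable R) (φ : Fin p → Fin p) →
  ∣ permutedRows? R? φ ∣ₜ ≡ p * ∣ R? ∣ᵣ
∣permutedRows∣ {p} {R} R? φ =
  length-filter-cartesianProduct (permutedRows? R? φ) R? p (cartesianProduct (allFin p) (allFin p))
    row (λ r∉R → r∉R ∘ proj₁) (allFin p)
  where
  open ≡-Reasoning
  row : ∀ {r} → r ∈ R →
    length (filter (λ cs → permutedRows? R? φ (r , cs)) (cartesianProduct (allFin p) (allFin p))) ≡ p
  row {r} r∈R = begin
    -- Inside row `r` the condition `r ∈ R` does not vary with the column, and each column `c`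
    -- carries the single symbol `φ r ⊕ c`.
    _ ≡⟨ length-filter-cartesianProduct (λ cs → permutedRows? R? φ (r , cs)) (λ _ → R? r) 1 (allFin p)
           (λ {c} _ → length-filter-unique (λ s → permutedRows? R? φ (r , c , s))
                       (r∈R , refl) (sym ∘ proj₂) (allFin⁺ p) (∈-allFin _))
           (λ r∉R → r∉R ∘ proj₁) (allFin p) ⟩
    1 * length (filter (λ _ → R? r) (allFin p)) ≡⟨ +-identityʳ _ ⟩
    length (filter (λ _ → R? r) (allFin p))     ≡⟨ cong length (filter-all (λ _ → R? r)
                                                                     (All.universal (λ _ → r∈R) (allFin p))) ⟩
    length (allFin p)                           ≡⟨ length-tabulate id ⟩
    p                                           ∎

-- The derangement `φ` read off from the symbol `s`.

module RowPermutation {k : ℕ} {T T′ : TripleSet p}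
  (trade : IsOrthogonalTradeWithMate 1 k T T′) (s : Fin p) where

  open IsOrthogonalTradeWithMate trade
  open IsLatinTradeWithMate latinTrade
  module Mate   = IsPartialLatinSquare partialLatin
  module Square = IsLatinSquare latin
  module L′     = IsLatinSquare (AreOrthogonal.latinˡ orthogonal)

  L′ : TripleSet p
  L′ = (B 1 ∖ T) ∪ T′

  R : Pred (Fin p) 0ℓ
  R = rowsContaining s T

  ≡⇒B₁ : {i j x : Fin p} → x ≡ i ⊕ j → (i , j , x) ∈ B 1
  ≡⇒B₁ {i} {j} x≡i⊕j = trans x≡i⊕j (cong (_⊕ j) (sym (·-identityˡ i)))

  B₁⇒≡ : {i j x : Fin p} → (i , j , x) ∈ B 1 → x ≡ i ⊕ j
  B₁⇒≡ {i} {j} x≡1·i⊕j = trans x≡1·i⊕j (cong (_⊕ j) (·-identityˡ i))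

  -- Cancellation and the solving of equations come from `B 1` being Latin, which the trade
  -- supplies; `⊕-solveˡ` and `⊕-solveʳ` then stand in for subtraction.
  ⊕-cancelˡ : {i j j′ : Fin p} → i ⊕ j ≡ i ⊕ j′ → j ≡ j′
  ⊕-cancelˡ {i} {j} eq = ∃!-unique (Square.row i (i ⊕ j)) (≡⇒B₁ refl) (≡⇒B₁ eq)

  ⊕-cancelʳ : {i i′ j : Fin p} → i ⊕ j ≡ i′ ⊕ j → i ≡ i′
  ⊕-cancelʳ {i} {_} {j} eq = ∃!-unique (Square.column j (i ⊕ j)) (≡⇒B₁ refl) (≡⇒B₁ eq)

  ⊕-solveˡ : (i x : Fin p) → ∃ λ j → x ≡ i ⊕ j
  ⊕-solveˡ i x with Square.row i x
  ... | j , x∈B₁ , _ = j , B₁⇒≡ x∈B₁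

  ⊕-solveʳ : (j x : Fin p) → ∃ λ i → x ≡ i ⊕ j
  ⊕-solveʳ j x with Square.column j x
  ... | i , x∈B₁ , _ = i , B₁⇒≡ x∈B₁

  σ : Fin p → Fin p
  σ r = proj₁ (L′.row r s)

  σ∈L′ : ∀ r → (r , σ r , s) ∈ L′
  σ∈L′ r = proj₁ (proj₂ (L′.row r s))

  σ-unique : ∀ {r c} → (r , c , s) ∈ L′ → σ r ≡ c
  σ-unique {r} = proj₂ (proj₂ (L′.row r s))

  -- This is `s` - `σ r`: the row in which `B 1` itself has `s` in column `σ r`.
  φ : Fin p → Fin p
  φ r = proj₁ (⊕-solveʳ (σ r) s)

  φ⊕σ : ∀ r → s ≡ φ r ⊕ σ r
  φ⊕σ r = proj₂ (⊕-solveʳ (σ r) s)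

  φ-unique : ∀ {i r} → s ≡ i ⊕ σ r → φ r ≡ i
  φ-unique {_} {r} eq = ⊕-cancelʳ (trans (sym (φ⊕σ r)) eq)

  T′⇒R : ∀ {r c} → (r , c , s) ∈ T′ → r ∈ R
  T′⇒R {r} ∈T′ = Equivalence.from (rowSymbols r s) (_ , ∈T′)

  R⇒T′ : ∀ {r} → r ∈ R → (r , σ r , s) ∈ T′
  R⇒T′ {r} r∈R with Equivalence.to (rowSymbols r s) r∈R
  ... | c , ∈T′ = subst (λ c → (r , c , s) ∈ T′) (sym (σ-unique (inj₂ ∈T′))) ∈T′

  -- `T′` has `s` in column `σ r`, hence so does `T`. As `T` lies in `B 1`, the row can only be
  -- `φ r`.
  R⇒φ∈T : ∀ {r} → r ∈ R → (φ r , σ r , s) ∈ T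
  R⇒φ∈T {r} r∈R with Equivalence.from (columnSymbols (σ r) s) (r , R⇒T′ r∈R)
  ... | i , ∈T = subst (λ i → (i , σ r , s) ∈ T) (sym (φ-unique (B₁⇒≡ (subset ∈T)))) ∈T

  φ-maps : ∀ {r} → r ∈ R → φ r ∈ R
  φ-maps r∈R = _ , R⇒φ∈T r∈R

  φ-deranges : ∀ r → r ∈ R → φ r ≢ r
  φ-deranges r r∈R φr≡r =
    disjoint (subst (λ i → (i , σ r , s) ∈ T) φr≡r (R⇒φ∈T r∈R) , R⇒T′ r∈R)

  -- Replaces a decision of `r ∈ R`: the entry of `L′` at `(r , σ r)` comes either from `B 1`, which
  -- forces `φ r ≡ r`, or from `T′`.
  moved⊎fixed : ∀ r → r ∈ R ⊎ φ r ≡ r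
  moved⊎fixed r with σ∈L′ r
  ... | inj₁ (∈B₁ , _) = inj₂ (φ-unique (B₁⇒≡ ∈B₁))
  ... | inj₂ ∈T′       = inj₁ (T′⇒R ∈T′)

  -- Equal values of `φ` force equal columns `σ`, and `s` occurs only once in a column of `L′`.
  φ-injective : ∀ {r r′} → φ r ≡ φ r′ → r ≡ r′
  φ-injective {r} {r′} φr≡φr′ = ∃!-unique (L′.column (σ r) s) (σ∈L′ r)
    (subst (λ c → (r′ , c , s) ∈ L′) (sym σr≡σr′) (σ∈L′ r′))
    where
    σr≡σr′ : σ r ≡ σ r′
    σr≡σr′ = ⊕-cancelˡ (trans (sym (φ⊕σ r)) (trans (φ⊕σ r′) (cong (_⊕ σ r′) (sym φr≡φr′))))

  -- Let `c` be the column in which row `r′` of `B 1` has `s`; the preimage is the row in which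
  -- column `c` of `L′` has `s`.
  φ-surjective : ∀ r′ → ∃ λ r → φ r ≡ r′
  φ-surjective r′ with ⊕-solveˡ r′ s
  ... | c , s≡r′⊕c with L′.column c s
  ... | r , ∈L′ , _ = r , φ-unique (trans s≡r′⊕c (cong (r′ ⊕_) (sym (σ-unique ∈L′))))

  φ-isPermutation : IsPermutationOf R φ
  φ-isPermutation = record
    { maps       = φ-maps
    ; injective  = λ _ _ → φ-injective
    ; surjective = surjective
    }
    where
    surjective : ∀ {r′} → r′ ∈ R → ∃ λ r → r ∈ R × φ r ≡ r′
    surjective {r′} r′∈R with φ-surjective r′
    ... | r , φr≡r′ with moved⊎fixed r
    ... | inj₁ r∈R  = r , r∈R , φr≡r′
    ... | inj₂ φr≡r = r , subst R (trans (sym φr≡r′) φr≡r) r′∈R , φr≡r′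

  -- The row-permuted square and the new trade.

  U U′ N : TripleSet p
  U  = permutedRows R id
  U′ = permutedRows R φ
  N  = (B 1 ∖ U) ∪ U′

  -- Since `φ` fixes the rows outside `R`, one formula describes both the kept and the replaced rows
  -- of `N`.
  N⇒≡ : ∀ {i j x} → (i , j , x) ∈ N → x ≡ φ i ⊕ j
  N⇒≡ {i} {j} (inj₁ (∈B₁ , ∉U)) with moved⊎fixed i
  ... | inj₁ i∈R  = ⊥-elim (∉U (i∈R , B₁⇒≡ ∈B₁))
  ... | inj₂ φi≡i = trans (B₁⇒≡ ∈B₁) (cong (_⊕ j) (sym φi≡i))
  N⇒≡ (inj₂ (_ , x≡φi⊕j)) = x≡φi⊕j

  ≡⇒N : ∀ {i j x} → x ≡ φ i ⊕ j → (i , j , x) ∈ N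
  ≡⇒N {i} {j} x≡φi⊕j with moved⊎fixed i
  ... | inj₁ i∈R  = inj₂ (i∈R , x≡φi⊕j)
  ... | inj₂ φi≡i = inj₁ ( ≡⇒B₁ (trans x≡φi⊕j (cong (_⊕ j) φi≡i))
                         , λ (i∈R , _) → φ-deranges i i∈R φi≡i)

  N-isLatin : IsLatinSquare N
  N-isLatin = record
    { cell   = λ i j → φ i ⊕ j , ≡⇒N refl , sym ∘ N⇒≡
    ; row    = λ i x → let j , x≡φi⊕j = ⊕-solveˡ (φ i) x in
        j , ≡⇒N x≡φi⊕j , λ ∈N → ⊕-cancelˡ (trans (sym x≡φi⊕j) (N⇒≡ ∈N))
    ; column = column
    }
    where
    column : ∀ j x → ∃! _≡_ λ i → (i , j , x) ∈ N
    column j x with ⊕-solveʳ j x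
    ... | r , x≡r⊕j with φ-surjective r
    ... | i , refl = i , ≡⇒N x≡r⊕j , λ ∈N → φ-injective (⊕-cancelʳ (trans (sym x≡r⊕j) (N⇒≡ ∈N)))

  -- The entry of B_k at (r , σ r) is y′ exactly when k r − φ r = y′ − s. Taking
  -- y′ ⊕ x ≡ y ⊕ s makes this the condition k r − φ r = y − x that determines
  -- the row in which N and B_k superimpose to (x , y).
  N-superimpose : ∀ x y → ∃! _≡_ λ ((i , j) : Fin p × Fin p) →
                    (i , j , x) ∈ N × (i , j , y) ∈ B k
  N-superimpose x y with ⊕-solveʳ x (y ⊕ s)
  ... | y′ , y⊕s≡y′⊕x with AreOrthogonal.superimpose orthogonal s y′
  ... | (i , c) , (∈L′ , y′≡ki⊕c) , unique with ⊕-solveˡ (φ i) x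
  ... | j , x≡φi⊕j = (i , j) , (≡⇒N x≡φi⊕j , y≡ki⊕j) , N-unique
    where
    open ≡-Reasoning
    y≡ki⊕j : y ≡ k · i ⊕ j
    y≡ki⊕j = ⊕-cancelʳ (begin
      y ⊕ s                      ≡⟨ y⊕s≡y′⊕x ⟩
      y′ ⊕ x                     ≡⟨ cong₂ _⊕_ y′≡ki⊕c x≡φi⊕j ⟩
      (k · i ⊕ c) ⊕ (φ i ⊕ j)    ≡⟨ ⊕-swapʳ (k · i) c (φ i) j ⟩
      -- The column `c` is `σ i`, so the second bracket is `s` and cancels.
      (k · i ⊕ j) ⊕ (φ i ⊕ c)    ≡⟨ cong (λ z → (k · i ⊕ j) ⊕ (φ i ⊕ z)) (σ-unique ∈L′) ⟨
      (k · i ⊕ j) ⊕ (φ i ⊕ σ i)  ≡⟨ cong ((k · i ⊕ j) ⊕_) (φ⊕σ i) ⟨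
      (k · i ⊕ j) ⊕ s            ∎)

    -- Any such row `i′` makes `(i′ , σ i′)` a cell where `L′` and `B k` superimpose to `(s , y′)`;
    -- that cell is unique.
    row-unique : ∀ {i′ j′} → x ≡ φ i′ ⊕ j′ → y ≡ k · i′ ⊕ j′ → i ≡ i′
    row-unique {i′} {j′} x≡φi′⊕j′ y≡ki′⊕j′ = cong proj₁ (unique (σ∈L′ i′ , ⊕-cancelʳ (begin
      y′ ⊕ x                            ≡⟨ y⊕s≡y′⊕x ⟨
      y ⊕ s                             ≡⟨ cong₂ _⊕_ y≡ki′⊕j′ (φ⊕σ i′) ⟩
      (k · i′ ⊕ j′) ⊕ (φ i′ ⊕ σ i′)     ≡⟨ ⊕-swapʳ (k · i′) j′ (φ i′) (σ i′) ⟩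
      (k · i′ ⊕ σ i′) ⊕ (φ i′ ⊕ j′)     ≡⟨ cong ((k · i′ ⊕ σ i′) ⊕_) x≡φi′⊕j′ ⟨
      (k · i′ ⊕ σ i′) ⊕ x               ∎)))

    N-unique : ∀ {ij} → (proj₁ ij , proj₂ ij , x) ∈ N × (proj₁ ij , proj₂ ij , y) ∈ B k →
               (i , j) ≡ ij
    N-unique (∈N , ∈B) with row-unique (N⇒≡ ∈N) ∈B
    ... | refl = cong (i ,_) (⊕-cancelˡ (trans (sym x≡φi⊕j) (N⇒≡ ∈N)))

  U-isOrthogonalTradeWithMate : IsOrthogonalTradeWithMate 1 k U U′
  U-isOrthogonalTradeWithMate = record
    { latinTrade = record
      { latin         = latin
      ; subset        = ≡⇒B₁ ∘ proj₂
      ; partialLatin  = record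
        { cell   = λ (_ , e) (_ , e′) → trans e (sym e′)
        ; row    = λ (_ , e) (_ , e′) → ⊕-cancelˡ (trans (sym e) e′)
        ; column = λ (_ , e) (_ , e′) → φ-injective (⊕-cancelʳ (trans (sym e) e′))
        }
      ; sameCells     = λ i j → mk⇔ (λ (_ , i∈R , _) → _ , i∈R , refl) (λ (_ , i∈R , _) → _ , i∈R , refl)
      ; disjoint      = λ {(i , _)} ((i∈R , e) , (_ , e′)) →
          φ-deranges i i∈R (⊕-cancelʳ (trans (sym e′) e))
      -- In a row of `R`, both `U` and `U′` contain every symbol.
      ; rowSymbols    = λ i x → mk⇔
          (λ (_ , i∈R , _) → let j , e = ⊕-solveˡ (φ i) x in j , i∈R , e)
          (λ (_ , i∈R , _) → let j , e = ⊕-solveˡ i x in j , i∈R , e)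
      ; columnSymbols = λ j x → mk⇔
          -- The symbol of `U` in row `i` moves to the preimage of `i` under `φ`; conversely, the
          -- symbol of `U′` in row `i` comes from row `φ i` of `U`.
          (λ (_ , i∈R , e) → let r , r∈R , φr≡i = IsPermutationOf.surjective φ-isPermutation i∈R in
             r , r∈R , trans e (cong (_⊕ j) (sym φr≡i)))
          (λ (i , i∈R , e) → φ i , φ-maps i∈R , e)
      }
    ; orthogonal = record
      { latinˡ      = N-isLatin
      ; latinʳ      = AreOrthogonal.latinʳ orthogonal
      ; superimpose = N-superimpose
      }
    }

theorem4p1 : ∀ (p : ℕ) → Prime p → ¬ (2 ∣ p) →
    ∀ (k : ℕ) → 2 ≤ k → k ≤ p ∸ 1 →
    ∀ (T : TripleSet p) (T? : Decidable T) → IsOrthogonalTrade 1 k T →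
    ∀ (s : Fin p) → OccursIn s T →
    let R  = rowsContaining s T
        R? = rowsContaining? s T?
        U  = permutedRows R id
        U? = permutedRows? R? id
    in ∃ λ (φ : Fin p → Fin p) →
         IsPermutationOf R φ
       × (∀ r → r ∈ R → φ r ≢ r)
       × IsOrthogonalTradeWithMate 1 k U (permutedRows R φ)
       × ∣ U? ∣ₜ ≡ p * ∣ R? ∣ᵣ
theorem4p1 p _ _ k _ _ T T? (T′ , trade) s _ =
  φ , φ-isPermutation , φ-deranges , U-isOrthogonalTradeWithMate ,
  ∣permutedRows∣ (rowsContaining? s T?) id
  where open RowPermutation {k = k} {T = T} trade s
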